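{- For any integers $m,n$ with $n-1\geq m\geq 0$, $$\sum_{k=1}^n k\,(-1)^k q^{\binom{k}{2}} \left[{n \atop k}\right]_q q^{ -mk}=(-1)^{m+1}q^{ -\binom{m+1}{2}}(q;q)_m\,(q;q)_{n-m-1}.$$
   Context: $q$ is a complex number with $0<|q|<1$. For an integer $n\ge 0$, $(a;q)_n=\prod_{j=0}^{n-1}(1-aq^j)$ (so $(a;q)_0=1$), and the $q$-binomial coefficient is $\left[{n\atop k}\right]_q=\frac{(q;q)_n}{(q;q)_k(q;q)_{n-k}}$. -}

module Defs where

open import Level using (Level; _⊔_) renaming (suc to lsuc)
open import Algebra.Bundles using (CommutativeRing; RawRing; Semiring)
open import Algebra.Core using (Op₁; Op₂)
open import Algebra.Structures using (IsCommutativeRing)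
open import Algebra.Apartness.Bundles using (HeytingCommutativeRing; HeytingField)
open import Algebra.Apartness.Structures using (IsHeytingField)
import Algebra.Apartness.Properties.HeytingCommutativeRing as HeytingProperties
import Algebra.Definitions.RawSemiring as RawSemiringDefinitions
import Algebra.Properties.AbelianGroup as AbelianGroupProperties
import Algebra.Properties.Ring as RingProperties
import Algebra.Properties.Semiring.Mult as SemiringMult
import Algebra.Solver.Ring as RingSolver
open import Algebra.Solver.Ring.AlmostCommutativeRing
  using (fromCommutativeRing; _-Raw-AlmostCommutative⟶_)
open import Data.Fin.Base using (Fin; zero; suc; toℕ)
open import Data.Integer.Base as ℤ using (ℤ; +_; -[1+_])
import Data.Integer.Properties as ℤ
open import Data.Maybe.Base using (Maybe; just; nothing)
open import Data.Nat.Base as ℕ using (ℕ; zero; suc; _∸_)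
import Data.Nat.Properties as ℕ
open import Data.Product.Base using (_×_; _,_; ∃-syntax; proj₁; proj₂)
open import Data.Sum.Base using (_⊎_; inj₁; inj₂)
open import Function.Base using (_∘_)
open import Relation.Binary.Core using (Rel)
open import Relation.Binary.Structures using (IsStrictPartialOrder)
import Relation.Binary.Reasoning.Setoid as ≈-Reasoning
open import Relation.Binary.PropositionalEquality as ≡ using (_≡_)
open import Relation.Nullary using (¬_; yes; no; contradiction)

-- The real numbers, given by their usual axioms: an Archimedean,
-- Cauchy-complete ordered field.  The field axioms are those of a
-- Heyting field for the apartness "x < y or y < x", so that the axioms
-- are also satisfied constructively; classically this apartness is _≉_
-- and the order is total.

record RealField c ℓ₁ ℓ₂ : Set (lsuc (c ⊔ ℓ₁ ⊔ ℓ₂)) where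
  infix  8 -_
  infixl 7 _*_
  infixl 6 _+_
  infix  4 _≈_ _<_ _≤_ _#_
  field
    Carrier : Set c
    _≈_     : Rel Carrier ℓ₁
    _<_     : Rel Carrier ℓ₂
    _+_     : Op₂ Carrier
    _*_     : Op₂ Carrier
    -_      : Op₁ Carrier
    0#      : Carrier
    1#      : Carrier

  _≤_ : Rel Carrier ℓ₂
  x ≤ y = ¬ (y < x)

  _#_ : Rel Carrier ℓ₂
  x # y = x < y ⊎ y < x

  field
    isHeytingField       : IsHeytingField _≈_ _#_ _+_ _*_ -_ 0# 1#
    isStrictPartialOrder : IsStrictPartialOrder _≈_ _<_
    +-monoˡ-<            : ∀ {x y} z → x < y → x + z < y + z
    *-pos                : ∀ {x y} → 0# < x → 0# < y → 0# < x * y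

  open IsHeytingField isHeytingField public
  open IsStrictPartialOrder isStrictPartialOrder public
    using (<-resp-≈; <-respʳ-≈; <-respˡ-≈)
    renaming (irrefl to <-irrefl; trans to <-trans; asym to <-asym)

  heytingField : HeytingField c ℓ₁ ℓ₂
  heytingField = record { isHeytingField = isHeytingField }

  open HeytingField heytingField public using (heytingCommutativeRing)
  open HeytingCommutativeRing heytingCommutativeRing public using (commutativeRing)
  open CommutativeRing commutativeRing using (semiring)
  open RawSemiringDefinitions (Semiring.rawSemiring semiring) using () renaming (_×_ to _·_)

  ∣_-_∣<_ : Carrier → Carrier → Carrier → Set ℓ₂
  ∣ x - y ∣< ε = (x + - y < ε) × (y + - x < ε)

  Cauchy : (ℕ → Carrier) → Set (c ⊔ ℓ₂)
  Cauchy s = ∀ ε → 0# < ε → ∃[ N ] (∀ i j → N ℕ.≤ i → N ℕ.≤ j → ∣ s i - s j ∣< ε)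

  _⟶_ : (ℕ → Carrier) → Carrier → Set (c ⊔ ℓ₂)
  s ⟶ l = ∀ ε → 0# < ε → ∃[ N ] (∀ i → N ℕ.≤ i → ∣ s i - l ∣< ε)

  field
    archimedean : ∀ x → ∃[ n ] x < n · 1#
    complete    : ∀ s → Cauchy s → ∃[ l ] s ⟶ l

-- The ring solver with integer coefficients, so that cancellation is
-- recognised in an arbitrary commutative ring.

module IntegerCoefficientSolver {c ℓ} (R : CommutativeRing c ℓ) where
  open CommutativeRing R
  open RingProperties ring
  open AbelianGroupProperties +-abelianGroup using (⁻¹-∙-comm)
  open SemiringMult semiring using (×-homo-+; ×1-homo-*) renaming (_×_ to _·_)
  open ≈-Reasoning setoid

  ⟦_⟧ℤ : ℤ → Carrier
  ⟦ + n ⟧ℤ      = n · 1#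
  ⟦ -[1+ n ] ⟧ℤ = - (suc n · 1#)

  ⊖-homo : ∀ m n → ⟦ m ℤ.⊖ n ⟧ℤ ≈ m · 1# - n · 1#
  ⊖-homo m zero = begin
    m · 1#       ≈⟨ +-identityʳ _ ⟨
    m · 1# + 0#  ≈⟨ +-congˡ -0#≈0# ⟨
    m · 1# - 0#  ∎
  ⊖-homo zero (suc n) = sym (+-identityˡ _)
  ⊖-homo (suc m) (suc n) = begin
    ⟦ suc m ℤ.⊖ suc n ⟧ℤ                  ≡⟨ ≡.cong ⟦_⟧ℤ (ℤ.[1+m]⊖[1+n]≡m⊖n m n) ⟩
    ⟦ m ℤ.⊖ n ⟧ℤ                          ≈⟨ ⊖-homo m n ⟩
    m · 1# - n · 1#                       ≈⟨ +-identityˡ _ ⟨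
    0# + (m · 1# - n · 1#)                ≈⟨ +-congʳ (-‿inverseʳ 1#) ⟨
    (1# - 1#) + (m · 1# - n · 1#)         ≈⟨ +-assoc _ _ _ ⟩
    1# + (- 1# + (m · 1# - n · 1#))       ≈⟨ +-congˡ (+-assoc _ _ _) ⟨
    1# + ((- 1# + m · 1#) - n · 1#)       ≈⟨ +-congˡ (+-congʳ (+-comm _ _)) ⟩
    1# + ((m · 1# - 1#) - n · 1#)         ≈⟨ +-congˡ (+-assoc _ _ _) ⟩
    1# + (m · 1# + (- 1# - n · 1#))       ≈⟨ +-assoc _ _ _ ⟨
    (1# + m · 1#) + (- 1# - n · 1#)       ≈⟨ +-congˡ (⁻¹-∙-comm _ _) ⟩
    suc m · 1# - suc n · 1#               ∎

  -‿homo : ∀ i → ⟦ ℤ.- i ⟧ℤ ≈ - ⟦ i ⟧ℤ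
  -‿homo (+ zero)  = sym -0#≈0#
  -‿homo (+ suc n) = refl
  -‿homo -[1+ n ]  = sym (-‿involutive _)

  +-homo : ∀ i j → ⟦ i ℤ.+ j ⟧ℤ ≈ ⟦ i ⟧ℤ + ⟦ j ⟧ℤ
  +-homo (+ m)    (+ n)    = ×-homo-+ 1# m n
  +-homo (+ m)    -[1+ n ] = ⊖-homo m (suc n)
  +-homo -[1+ m ] (+ n)    = trans (⊖-homo n (suc m)) (+-comm _ _)
  +-homo -[1+ m ] -[1+ n ] = begin
    - (suc (suc (m ℕ.+ n)) · 1#)        ≡⟨ ≡.cong (λ k → - (suc k · 1#)) (ℕ.+-suc m n) ⟨
    - ((suc m ℕ.+ suc n) · 1#)          ≈⟨ -‿cong (×-homo-+ 1# (suc m) (suc n)) ⟩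
    - (suc m · 1# + suc n · 1#)         ≈⟨ ⁻¹-∙-comm _ _ ⟨
    - (suc m · 1#) + - (suc n · 1#)     ∎

  *-homo⁺ : ∀ m n → ⟦ + m ℤ.* + n ⟧ℤ ≈ m · 1# * (n · 1#)
  *-homo⁺ m n = begin
    ⟦ + m ℤ.* + n ⟧ℤ    ≡⟨ ≡.cong ⟦_⟧ℤ (ℤ.pos-* m n) ⟨
    (m ℕ.* n) · 1#      ≈⟨ ×1-homo-* m n ⟩
    m · 1# * (n · 1#)   ∎

  *-homo : ∀ i j → ⟦ i ℤ.* j ⟧ℤ ≈ ⟦ i ⟧ℤ * ⟦ j ⟧ℤ
  *-homo (+ m) (+ n) = *-homo⁺ m n
  *-homo (+ m) -[1+ n ] = begin
    ⟦ + m ℤ.* -[1+ n ] ⟧ℤ           ≡⟨ ≡.cong ⟦_⟧ℤ (ℤ.neg-distribʳ-* (+ m) (+ suc n)) ⟨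
    ⟦ ℤ.- (+ m ℤ.* + suc n) ⟧ℤ      ≈⟨ -‿homo (+ m ℤ.* + suc n) ⟩
    - ⟦ + m ℤ.* + suc n ⟧ℤ          ≈⟨ -‿cong (*-homo⁺ m (suc n)) ⟩
    - (m · 1# * (suc n · 1#))       ≈⟨ -‿distribʳ-* _ _ ⟩
    m · 1# * - (suc n · 1#)         ∎
  *-homo -[1+ m ] (+ n) = begin
    ⟦ -[1+ m ] ℤ.* + n ⟧ℤ           ≡⟨ ≡.cong ⟦_⟧ℤ (ℤ.neg-distribˡ-* (+ suc m) (+ n)) ⟨
    ⟦ ℤ.- (+ suc m ℤ.* + n) ⟧ℤ      ≈⟨ -‿homo (+ suc m ℤ.* + n) ⟩
    - ⟦ + suc m ℤ.* + n ⟧ℤ          ≈⟨ -‿cong (*-homo⁺ (suc m) n) ⟩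
    - (suc m · 1# * (n · 1#))       ≈⟨ -‿distribˡ-* _ _ ⟩
    - (suc m · 1#) * (n · 1#)       ∎
  *-homo -[1+ m ] -[1+ n ] = begin
    (suc m ℕ.* suc n) · 1#              ≈⟨ ×1-homo-* (suc m) (suc n) ⟩
    suc m · 1# * (suc n · 1#)           ≈⟨ -‿involutive _ ⟨
    - - (suc m · 1# * (suc n · 1#))     ≈⟨ -‿cong (-‿distribʳ-* _ _) ⟩
    - (suc m · 1# * - (suc n · 1#))     ≈⟨ -‿distribˡ-* _ _ ⟩
    - (suc m · 1#) * - (suc n · 1#)     ∎

  ℤ-rawRing : RawRing _ _
  ℤ-rawRing = record
    { Carrier = ℤ ; _≈_ = _≡_ ; _+_ = ℤ._+_ ; _*_ = ℤ._*_ ; -_ = ℤ.-_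
    ; 0# = ℤ.0ℤ ; 1# = ℤ.1ℤ }

  morphism : ℤ-rawRing -Raw-AlmostCommutative⟶ fromCommutativeRing R
  morphism = record
    { ⟦_⟧ = ⟦_⟧ℤ ; +-homo = +-homo ; *-homo = *-homo ; -‿homo = -‿homo
    ; 0-homo = refl ; 1-homo = +-identityʳ 1# }

  _coeff≟_ : ∀ i j → Maybe (⟦ i ⟧ℤ ≈ ⟦ j ⟧ℤ)
  i coeff≟ j with i ℤ.≟ j
  ... | yes ≡.refl = just refl
  ... | no  _      = nothing

  open RingSolver ℤ-rawRing (fromCommutativeRing R) morphism _coeff≟_ public
    using (solve; _:=_; _:+_; _:*_; _:-_; :-_; con)

module RealFieldProperties {c ℓ₁ ℓ₂} (ℝ : RealField c ℓ₁ ℓ₂) where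
  open RealField ℝ
  open HeytingProperties heytingCommutativeRing public
  open IntegerCoefficientSolver commutativeRing

  <-cotrans : ∀ {x y} → x < y → ∀ z → x < z ⊎ z < y
  <-cotrans x<y z with #-cotrans (inj₁ x<y) z
  ... | inj₁ (inj₁ x<z) = inj₁ x<z
  ... | inj₁ (inj₂ z<x) = inj₂ (<-trans z<x x<y)
  ... | inj₂ (inj₁ z<y) = inj₂ z<y
  ... | inj₂ (inj₂ y<z) = inj₁ (<-trans x<y y<z)

  x<y⇒0<y-x : ∀ {x y} → x < y → 0# < y - x
  x<y⇒0<y-x {x} x<y = <-respˡ-≈ (-‿inverseʳ x) (+-monoˡ-< (- x) x<y)

  x<y⇒x-y<0 : ∀ {x y} → x < y → x - y < 0#
  x<y⇒x-y<0 {y = y} x<y = <-respʳ-≈ (-‿inverseʳ y) (+-monoˡ-< (- y) x<y)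

  0<y-x⇒x<y : ∀ {x y} → 0# < y - x → x < y
  0<y-x⇒x<y {x} {y} p = <-respˡ-≈ (+-identityˡ x)
    (<-respʳ-≈ (solve 2 (λ x y → (y :- x) :+ x := y) refl x y) (+-monoˡ-< x p))

  x#y⇒x-y#0 : ∀ {x y} → x # y → x - y # 0#
  x#y⇒x-y#0 (inj₁ x<y) = inj₁ (x<y⇒x-y<0 x<y)
  x#y⇒x-y#0 (inj₂ y<x) = inj₂ (x<y⇒0<y-x y<x)

  x-y#0⇒x#y : ∀ {x y} → x - y # 0# → x # y
  x-y#0⇒x#y p with #⇒invertible p
  ... | v , v*p≈1 , _ = invertibleˡ⇒# (v , trans (*-congˡ (sym (x-0≈x _))) v*p≈1)

  x*x-pos : ∀ {x} → x # 0# → 0# < x * x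
  x*x-pos (inj₂ 0<x) = *-pos 0<x 0<x
  x*x-pos {x} (inj₁ x<0) =
    <-respʳ-≈ (solve 2 (λ x z → (con ℤ.0ℤ :- x) :* (con ℤ.0ℤ :- x) := x :* x) refl x x)
              (*-pos 0<-x 0<-x)
    where 0<-x = x<y⇒0<y-x x<0

  x*x-nonNeg : ∀ x → 0# ≤ x * x
  x*x-nonNeg x x*x<0 = <-irrefl x*x≈0 x*x<0
    where
    x≈0 : x ≈ 0#
    x≈0 = proj₁ (tight x 0#) (λ x#0 → <-asym (x*x-pos x#0) x*x<0)

    x*x≈0 : x * x ≈ 0#
    x*x≈0 = trans (*-congʳ x≈0) (zeroˡ x)

  0<1 : 0# < 1#
  0<1 = <-respʳ-≈ (*-identityˡ 1#) (x*x-pos 1#0)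

  pos+nonNeg : ∀ {x y} → 0# < x → 0# ≤ y → 0# < x + y
  pos+nonNeg {x} {y} 0<x 0≤y with <-cotrans 0<x (x + y)
  ... | inj₁ p = p
  ... | inj₂ x+y<x = contradiction
    (<-respˡ-≈ (solve 2 (λ x y → (x :+ y) :- x := y) refl x y) (x<y⇒x-y<0 x+y<x)) 0≤y

  pos*<1 : ∀ {x y} → x < 1# → 0# < y → y < 1# → x * y < 1#
  pos*<1 {x} {y} x<1 0<y y<1 = <-trans
    (0<y-x⇒x<y (<-respʳ-≈
      (trans (*-comm _ _) (trans (distribˡ y 1# (- x)) (+-cong (*-identityʳ y)
        (solve 2 (λ x y → y :* (:- x) := :- (x :* y)) refl x y))))
      (*-pos (x<y⇒0<y-x x<1) 0<y)))
    y<1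

  x*y#0⇒x#0 : ∀ {x y} → x * y # 0# → x # 0#
  x*y#0⇒x#0 {x} {y} xy#0 with #⇒invertible xy#0
  ... | v , v*xy≈1 , _ = invertibleˡ⇒# (v * y , trans
          (solve 4 (λ x y v z → v :* y :* (x :- z) := v :* (x :* y :- z) :+ (v :- v :* y) :* z)
                 refl x y v 0#)
          (trans (+-cong v*xy≈1 (zeroʳ _)) (+-identityʳ 1#)))

  x+y#0⇒x#0⊎y#0 : ∀ {x y} → x + y # 0# → x # 0# ⊎ y # 0#
  x+y#0⇒x#0⊎y#0 {x} {y} p with #-cotrans p y
  ... | inj₂ y#0 = inj₂ y#0
  ... | inj₁ x+y#y = inj₁ (#-congʳ (solve 2 (λ x y → (x :+ y) :- y := x) refl x y)
                                   (x#y⇒x-y#0 x+y#y))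

module ComplexNumbers {c ℓ₁ ℓ₂} (ℝ : RealField c ℓ₁ ℓ₂) where
  open RealField ℝ public using ()
    renaming (Carrier to Real; _<_ to _<ʳ_; 0# to 0ʳ; 1# to 1ʳ)
  private
    module R = RealField ℝ
    module RP = RealFieldProperties ℝ
    open IntegerCoefficientSolver R.commutativeRing

  infix  8 -ᶜ_
  infixl 7 _*ᶜ_
  infixl 6 _+ᶜ_
  infix  4 _≈ᶜ_ _#ᶜ_ ∣_∣≈_
  infixr 4 _,_

  record ℂ : Set c where
    constructor mkℂ
    field
      re im : R.Carrier
  open ℂ public

  record _≈ᶜ_ (z w : ℂ) : Set ℓ₁ where
    constructor _,_
    field
      re-≈ : re z R.≈ re w
      im-≈ : im z R.≈ im w
  open _≈ᶜ_ public

  _#ᶜ_ : Rel ℂ ℓ₂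
  z #ᶜ w = re z R.# re w ⊎ im z R.# im w

  0ᶜ 1ᶜ : ℂ
  0ᶜ = mkℂ R.0# R.0#
  1ᶜ = mkℂ R.1# R.0#

  _+ᶜ_ _*ᶜ_ : Op₂ ℂ
  z +ᶜ w = mkℂ (re z R.+ re w) (im z R.+ im w)
  z *ᶜ w = mkℂ (re z R.* re w R.- im z R.* im w) (re z R.* im w R.+ im z R.* re w)

  -ᶜ_ : Op₁ ℂ
  -ᶜ z = mkℂ (R.- re z) (R.- im z)

  normSq : ℂ → R.Carrier
  normSq z = re z R.* re z R.+ im z R.* im z

  -- r is the modulus |z|, the non-negative square root of re² + im².
  record ∣_∣≈_ (z : ℂ) (r : R.Carrier) : Set (ℓ₁ ⊔ ℓ₂) where
    field
      nonNeg : R.0# R.≤ r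
      square : r R.* r R.≈ normSq z

  isCommutativeRing : IsCommutativeRing _≈ᶜ_ _+ᶜ_ _*ᶜ_ -ᶜ_ 0ᶜ 1ᶜ
  isCommutativeRing = record
    { isRing = record
      { +-isAbelianGroup = record
        { isGroup = record
          { isMonoid = record
            { isSemigroup = record
              { isMagma = record
                { isEquivalence = record
                  { refl  = R.refl , R.refl
                  ; sym   = λ (p , q) → R.sym p , R.sym q
                  ; trans = λ (p , q) (p′ , q′) → R.trans p p′ , R.trans q q′
                  }
                ; ∙-cong = λ (p , q) (p′ , q′) → R.+-cong p p′ , R.+-cong q q′
                }
              ; assoc = λ _ _ _ → R.+-assoc _ _ _ , R.+-assoc _ _ _
              }
            ; identity = (λ _ → R.+-identityˡ _ , R.+-identityˡ _)
                       , (λ _ → R.+-identityʳ _ , R.+-identityʳ _)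
            }
          ; inverse = (λ _ → R.-‿inverseˡ _ , R.-‿inverseˡ _)
                    , (λ _ → R.-‿inverseʳ _ , R.-‿inverseʳ _)
          ; ⁻¹-cong = λ (p , q) → R.-‿cong p , R.-‿cong q
          }
        ; comm = λ _ _ → R.+-comm _ _ , R.+-comm _ _
        }
      ; *-cong = *ᶜ-cong
      ; *-assoc = *ᶜ-assoc
      ; *-identity = *ᶜ-identityˡ
                   , (λ z → ≈ᶜ-trans (*ᶜ-comm z 1ᶜ) (*ᶜ-identityˡ z))
      ; distrib = *ᶜ-distribˡ
                , (λ z w v → ≈ᶜ-trans (*ᶜ-comm (w +ᶜ v) z) (≈ᶜ-trans (*ᶜ-distribˡ z w v)
                    (+ᶜ-cong (*ᶜ-comm z w) (*ᶜ-comm z v))))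
      }
    ; *-comm = *ᶜ-comm
    }
    where
    ≈ᶜ-trans : ∀ {z w v} → z ≈ᶜ w → w ≈ᶜ v → z ≈ᶜ v
    ≈ᶜ-trans (p , q) (p′ , q′) = R.trans p p′ , R.trans q q′

    +ᶜ-cong : ∀ {z z′ w w′} → z ≈ᶜ z′ → w ≈ᶜ w′ → z +ᶜ w ≈ᶜ z′ +ᶜ w′
    +ᶜ-cong (p , q) (p′ , q′) = R.+-cong p p′ , R.+-cong q q′

    *ᶜ-cong : ∀ {z z′ w w′} → z ≈ᶜ z′ → w ≈ᶜ w′ → z *ᶜ w ≈ᶜ z′ *ᶜ w′
    *ᶜ-cong (p , q) (p′ , q′) =
        R.+-cong (R.*-cong p p′) (R.-‿cong (R.*-cong q q′))
      , R.+-cong (R.*-cong p q′) (R.*-cong q p′)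

    *ᶜ-assoc : ∀ z w v → (z *ᶜ w) *ᶜ v ≈ᶜ z *ᶜ (w *ᶜ v)
    *ᶜ-assoc z w v =
        solve 6 (λ a b c d e f → (a :* c :- b :* d) :* e :- (a :* d :+ b :* c) :* f
                              := a :* (c :* e :- d :* f) :- b :* (c :* f :+ d :* e))
              R.refl (re z) (im z) (re w) (im w) (re v) (im v)
      , solve 6 (λ a b c d e f → (a :* c :- b :* d) :* f :+ (a :* d :+ b :* c) :* e
                              := a :* (c :* f :+ d :* e) :+ b :* (c :* e :- d :* f))
              R.refl (re z) (im z) (re w) (im w) (re v) (im v)

    *ᶜ-comm : ∀ z w → z *ᶜ w ≈ᶜ w *ᶜ z
    *ᶜ-comm z w =
        solve 4 (λ a b c d → a :* c :- b :* d := c :* a :- d :* b)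
              R.refl (re z) (im z) (re w) (im w)
      , solve 4 (λ a b c d → a :* d :+ b :* c := c :* b :+ d :* a)
              R.refl (re z) (im z) (re w) (im w)

    *ᶜ-identityˡ : ∀ z → 1ᶜ *ᶜ z ≈ᶜ z
    *ᶜ-identityˡ z =
        R.trans (R.+-cong (R.*-identityˡ _) (R.-‿cong (R.zeroˡ _)))
                (RP.x-0≈x _)
      , R.trans (R.+-cong (R.*-identityˡ _) (R.zeroˡ _)) (R.+-identityʳ _)

    *ᶜ-distribˡ : ∀ z w v → z *ᶜ (w +ᶜ v) ≈ᶜ z *ᶜ w +ᶜ z *ᶜ v
    *ᶜ-distribˡ z w v =
        solve 6 (λ a b c d e f → a :* (c :+ e) :- b :* (d :+ f)
                              := (a :* c :- b :* d) :+ (a :* e :- b :* f))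
              R.refl (re z) (im z) (re w) (im w) (re v) (im v)
      , solve 6 (λ a b c d e f → a :* (d :+ f) :+ b :* (c :+ e)
                              := (a :* d :+ b :* c) :+ (a :* f :+ b :* e))
              R.refl (re z) (im z) (re w) (im w) (re v) (im v)

  ℂ-commutativeRing : CommutativeRing c ℓ₁
  ℂ-commutativeRing = record { isCommutativeRing = isCommutativeRing }

  private
    module C = CommutativeRing ℂ-commutativeRing

  normSq-pos : ∀ {z} → z #ᶜ 0ᶜ → R.0# R.< normSq z
  normSq-pos (inj₁ a#0) = RP.pos+nonNeg (RP.x*x-pos a#0) (RP.x*x-nonNeg _)
  normSq-pos (inj₂ b#0) =
    R.<-respʳ-≈ (R.+-comm _ _) (RP.pos+nonNeg (RP.x*x-pos b#0) (RP.x*x-nonNeg _))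

  #ᶜ⇒-#ᶜ0 : ∀ {z w} → z #ᶜ w → z +ᶜ -ᶜ w #ᶜ 0ᶜ
  #ᶜ⇒-#ᶜ0 (inj₁ p) = inj₁ (RP.x#y⇒x-y#0 p)
  #ᶜ⇒-#ᶜ0 (inj₂ p) = inj₂ (RP.x#y⇒x-y#0 p)

  -#ᶜ0⇒#ᶜ : ∀ {z w} → z +ᶜ -ᶜ w #ᶜ 0ᶜ → z #ᶜ w
  -#ᶜ0⇒#ᶜ (inj₁ p) = inj₁ (RP.x-y#0⇒x#y p)
  -#ᶜ0⇒#ᶜ (inj₂ p) = inj₂ (RP.x-y#0⇒x#y p)

  *ᶜ≈1⇒#ᶜ0 : ∀ {z w} → z *ᶜ w ≈ᶜ 1ᶜ → z #ᶜ 0ᶜ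
  *ᶜ≈1⇒#ᶜ0 {z} {w} (p , _) with RP.x+y#0⇒x#0⊎y#0 (RP.#-congʳ (R.sym p) RP.1#0)
  ... | inj₁ q = inj₁ (RP.x*y#0⇒x#0 q)
  ... | inj₂ q = inj₂ (RP.x*y#0⇒x#0 (RP.#-congʳ
        (solve 2 (λ b d → (:- (b :* d)) := b :* (:- d)) R.refl (im z) (im w)) q))

  ℂ-inverse : ∀ {z} → z #ᶜ 0ᶜ → ∃[ w ] z *ᶜ w ≈ᶜ 1ᶜ
  ℂ-inverse {z} z#0 with R.#⇒invertible {x = normSq z} (inj₂ (normSq-pos z#0))
  ... | v , v*n≈1 , _ = mkℂ (re z R.* v) (R.- (im z R.* v))
      , ( R.trans (solve 3 (λ a b v → a :* (a :* v) :- b :* (:- (b :* v))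
                                   := v :* (a :* a :+ b :* b)) R.refl (re z) (im z) v)
                  (R.trans (R.*-congˡ (R.sym (RP.x-0≈x _))) v*n≈1)
        , solve 3 (λ a b v → a :* (:- (b :* v)) :+ b :* (a :* v) := con ℤ.0ℤ)
                R.refl (re z) (im z) v )

  isHeytingField : IsHeytingField _≈ᶜ_ _#ᶜ_ _+ᶜ_ _*ᶜ_ -ᶜ_ 0ᶜ 1ᶜ
  isHeytingField = record
    { isHeytingCommutativeRing = record
      { isCommutativeRing = isCommutativeRing
      ; isApartnessRelation = record
        { irrefl = λ { (p , _) (inj₁ q) → R.#-irrefl p q ; (_ , p) (inj₂ q) → R.#-irrefl p q }
        ; sym = λ { (inj₁ p) → inj₁ (R.#-sym p) ; (inj₂ p) → inj₂ (R.#-sym p) }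
        ; cotrans = cotrans
        }
      ; #⇒invertible = λ z#w → let v , p = ℂ-inverse (#ᶜ⇒-#ᶜ0 z#w) in
                                v , C.trans (C.*-comm v _) p , p
      ; invertible⇒# = λ (v , _ , p) → -#ᶜ0⇒#ᶜ (*ᶜ≈1⇒#ᶜ0 {w = v} p)
      }
    ; tight = λ z w →
          (λ ¬z#w → proj₁ (R.tight _ _) (¬z#w ∘ inj₁) , proj₁ (R.tight _ _) (¬z#w ∘ inj₂))
        , (λ { (p , _) (inj₁ q) → R.#-irrefl p q ; (_ , p) (inj₂ q) → R.#-irrefl p q })
    }
    where
    cotrans : ∀ {z w} → z #ᶜ w → ∀ v → z #ᶜ v ⊎ v #ᶜ w
    cotrans (inj₁ p) v with R.#-cotrans p (re v)
    ... | inj₁ q = inj₁ (inj₁ q)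
    ... | inj₂ q = inj₂ (inj₁ q)
    cotrans (inj₂ p) v with R.#-cotrans p (im v)
    ... | inj₁ q = inj₁ (inj₂ q)
    ... | inj₂ q = inj₂ (inj₂ q)

  ℂ-field : HeytingField c ℓ₁ ℓ₂
  ℂ-field = record { isHeytingField = isHeytingField }

module QSeries {c ℓ₁ ℓ₂} (K : HeytingField c ℓ₁ ℓ₂) where
  open HeytingField K hiding (zero)
  open HeytingProperties heytingCommutativeRing using (x#0y#0→xy#0; 1#0)
  open HeytingCommutativeRing heytingCommutativeRing using (commutativeRing)
  open CommutativeRing commutativeRing using (semiring)
  open RawSemiringDefinitions (Semiring.rawSemiring semiring) public
    using (_^_; sum; product) renaming (_×_ to _·_)

  inv : ∀ x → x # 0# → Carrier
  inv x x#0 = proj₁ (#⇒invertible x#0)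

  zpow : ∀ x → x # 0# → ℤ → Carrier
  zpow x x#0 (+ n)    = x ^ n
  zpow x x#0 -[1+ n ] = inv x x#0 ^ suc n

  ∑[1⋯_] : ℕ → (ℕ → Carrier) → Carrier
  ∑[1⋯ n ] f = sum {n} (λ i → f (suc (toℕ i)))

  qPoch : Carrier → Carrier → ℕ → Carrier
  qPoch a q n = product {n} (λ j → 1# - a * q ^ toℕ j)

  -- The second argument of qBinom makes the denominator invertible.
  QFactorials#0 : Carrier → Set ℓ₂
  QFactorials#0 q = ∀ n → qPoch q q n # 0#

  qBinom : ∀ q → QFactorials#0 q → ℕ → ℕ → Carrier
  qBinom q nz n k = qPoch q q n *
    inv (qPoch q q k * qPoch q q (n ∸ k)) (x#0y#0→xy#0 (nz k) (nz (n ∸ k)))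

  product#0 : ∀ {n} (f : Fin n → Carrier) → (∀ i → f i # 0#) → product f # 0#
  product#0 {zero}  f p = 1#0
  product#0 {suc n} f p = x#0y#0→xy#0 (p zero) (product#0 (f ∘ suc) (p ∘ suc))

-- For 0 < |q| < 1 every factor 1 - q^(j+1) is apart from 0, so division
-- by q and by (q;q)_n is legitimate.

module UnitDisc {c ℓ₁ ℓ₂} (ℝ : RealField c ℓ₁ ℓ₂) where
  open ComplexNumbers ℝ
  open QSeries ℂ-field
  private
    module R = RealField ℝ
    module RP = RealFieldProperties ℝ
    open IntegerCoefficientSolver R.commutativeRing

  normSq-* : ∀ z w → normSq (z *ᶜ w) R.≈ normSq z R.* normSq w
  normSq-* z w = solve 4 (λ a b c d →
      (a :* c :- b :* d) :* (a :* c :- b :* d) :+ (a :* d :+ b :* c) :* (a :* d :+ b :* c)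
      := (a :* a :+ b :* b) :* (c :* c :+ d :* d))
    R.refl (re z) (im z) (re w) (im w)

  modulus-pos⇒#0 : ∀ {z r} → ∣ z ∣≈ r → R.0# R.< r → z #ᶜ 0ᶜ
  modulus-pos⇒#0 {z} m 0<r
    with RP.x+y#0⇒x#0⊎y#0 {x = re z R.* re z} {y = im z R.* im z}
           (inj₂ (R.<-respʳ-≈ (∣_∣≈_.square m) (R.*-pos 0<r 0<r)))
  ... | inj₁ p = inj₁ (RP.x*y#0⇒x#0 p)
  ... | inj₂ p = inj₂ (RP.x*y#0⇒x#0 p)

  normSq<1⇒1-#0 : ∀ {z} → normSq z R.< R.1# → 1ᶜ +ᶜ -ᶜ z #ᶜ 0ᶜ
  normSq<1⇒1-#0 {z} n<1 = inj₁ (RP.x*y#0⇒x#0 {y = R.1# R.+ re z} (inj₂ 0<[1-a][1+a]))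
    where
    a²<1 : re z R.* re z R.< R.1#
    a²<1 with RP.<-cotrans n<1 (re z R.* re z)
    ... | inj₂ p = p
    ... | inj₁ n<a² = contradiction
      (R.<-respˡ-≈ (solve 2 (λ x y → (x :+ y) :- x := y) R.refl (re z R.* re z) (im z R.* im z))
                   (RP.x<y⇒x-y<0 n<a²))
      (RP.x*x-nonNeg (im z))

    0<[1-a][1+a] : R.0# R.< (R.1# R.- re z) R.* (R.1# R.+ re z)
    0<[1-a][1+a] = R.<-respʳ-≈
      (R.trans (R.+-congʳ (R.sym (R.*-identityˡ R.1#)))
        (solve 2 (λ o a → o :* o :- a :* a := (o :- a) :* (o :+ a)) R.refl R.1# (re z)))
      (RP.x<y⇒0<y-x a²<1)

  qFactorials#0 : ∀ {q r} → ∣ q ∣≈ r → R.0# R.< r → r R.< R.1# → QFactorials#0 q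
  qFactorials#0 {q} {r} m 0<r r<1 n =
    product#0 {n} _ (λ j → normSq<1⇒1-#0 (proj₂ (powers (toℕ j))))
    where
    0<N<1 : R.0# R.< normSq q × normSq q R.< R.1#
    0<N<1 = R.<-respʳ-≈ (∣_∣≈_.square m) (R.*-pos 0<r 0<r)
          , R.<-respˡ-≈ (∣_∣≈_.square m) (RP.pos*<1 r<1 0<r r<1)

    powers : ∀ j → R.0# R.< normSq (q *ᶜ q ^ j) × normSq (q *ᶜ q ^ j) R.< R.1#
    powers zero = R.<-respʳ-≈ (R.sym N[q*1]≈N) (proj₁ 0<N<1)
                , R.<-respˡ-≈ (R.sym N[q*1]≈N) (proj₂ 0<N<1)
      where
      q*1≈q : q *ᶜ 1ᶜ ≈ᶜ q
      q*1≈q = CommutativeRing.*-identityʳ ℂ-commutativeRing q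

      N[q*1]≈N : normSq (q *ᶜ 1ᶜ) R.≈ normSq q
      N[q*1]≈N = R.+-cong (R.*-cong (re-≈ q*1≈q) (re-≈ q*1≈q))
                          (R.*-cong (im-≈ q*1≈q) (im-≈ q*1≈q))
    powers (suc j) with powers j
    ... | 0<x , x<1 =
        R.<-respʳ-≈ (R.sym (normSq-* q (q *ᶜ q ^ j))) (R.*-pos (proj₁ 0<N<1) 0<x)
      , R.<-respˡ-≈ (R.sym (normSq-* q (q *ᶜ q ^ j))) (RP.pos*<1 (proj₂ 0<N<1) 0<x x<1)

{-# OPTIONS --safe #-}
-- With Lₙ w = ∑ₖ (-1)ᵏ q^(k C 2) [n k] w(k), Pascal's rule becomes, by summation
-- by parts, Lₙ₊₁ w = Lₙ (k ↦ qᵏ (w(k) - w(k+1))).  For w(k) = xᵏ this yields the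
-- q-binomial theorem Lₙ(xᵏ) = (x;q)ₙ, and for w(k) = k xᵏ the recursion
--   Dₙ₊₁(x) = (1 - x) Dₙ(qx) - x (qx;q)ₙ.
-- At x = q⁻ᵐ the last term vanishes for 0 < m ≤ n, so that m drops to 0, where
-- instead the first term vanishes and -(q;q)ₙ remains.
module Submission where

open import Defs
open import Data.Integer.Base using (+_) renaming (-_ to -ᶻ_)
open import Data.Nat.Base using (ℕ; suc; _∸_) renaming (_*_ to _*ᴺ_; _<_ to _<ᴺ_)
open import Data.Nat.Combinatorics using (_C_)
open import Algebra.Apartness.Bundles using (HeytingField; HeytingCommutativeRing)
import Algebra.Apartness.Properties.HeytingCommutativeRing as HeytingProperties
open import Algebra.Bundles using (CommutativeRing)
import Algebra.Properties.CommutativeMonoid.Sum as CommutativeMonoidSum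
import Algebra.Properties.CommutativeSemiring.Exp as CommutativeSemiringExp
import Algebra.Properties.Ring as RingProperties
import Algebra.Properties.Semiring.Exp as SemiringExp
import Algebra.Properties.Semiring.Mult as SemiringMult
import Algebra.Properties.Semiring.Sum as SemiringSum
import Algebra.Solver.Ring as RingSolver
open import Algebra.Solver.Ring.AlmostCommutativeRing
  using (fromCommutativeRing; _-Raw-AlmostCommutative⟶_)
open import Data.Fin.Base using (Fin; toℕ; inject₁; fromℕ)
open import Data.Fin.Properties using (toℕ<n; toℕ-inject₁; toℕ-fromℕ)
open import Data.Integer.Base as ℤ using (ℤ; -[1+_])
open import Data.Maybe.Base using (Maybe; map)
open import Data.Nat.Base as ℕ using (zero; s≤s; s<s; z<s)
open import Data.Nat.Combinatorics using (nC1≡n; nCk+nC[k+1]≡[n+1]C[k+1])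
import Data.Nat.Properties as ℕ
open import Data.Product.Base using (_,_; proj₁)
open import Function.Base using (_∘_)
open import Relation.Binary.PropositionalEquality as ≡ using (_≡_)
import Relation.Binary.Reasoning.Setoid as ≈-Reasoning

-- Normalisation of ring equations containing the unit.

-- IntegerCoefficientSolver interprets the constant 1 as 1# + 0#; here it is
-- interpreted as 1#, so that 1# may occur in the equations to be solved.
module UnitalSolver {c ℓ} (R : CommutativeRing c ℓ) where
  open CommutativeRing R
  open IntegerCoefficientSolver R
    using (⟦_⟧ℤ; ℤ-rawRing; +-homo; *-homo; -‿homo; _coeff≟_)

  ⟦_⟧¹ : ℤ → Carrier
  ⟦ + 1 ⟧¹ = 1#
  ⟦ i   ⟧¹ = ⟦ i ⟧ℤ

  ⟦⟧¹≈⟦⟧ℤ : ∀ i → ⟦ i ⟧¹ ≈ ⟦ i ⟧ℤ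
  ⟦⟧¹≈⟦⟧ℤ (+ 0)           = refl
  ⟦⟧¹≈⟦⟧ℤ (+ 1)           = sym (+-identityʳ 1#)
  ⟦⟧¹≈⟦⟧ℤ (+ suc (suc _)) = refl
  ⟦⟧¹≈⟦⟧ℤ -[1+ _ ]        = refl

  morphism : ℤ-rawRing -Raw-AlmostCommutative⟶ fromCommutativeRing R
  morphism = record
    { ⟦_⟧    = ⟦_⟧¹
    ; +-homo = λ i j → trans (⟦⟧¹≈⟦⟧ℤ (i ℤ.+ j))
        (trans (+-homo i j) (sym (+-cong (⟦⟧¹≈⟦⟧ℤ i) (⟦⟧¹≈⟦⟧ℤ j))))
    ; *-homo = λ i j → trans (⟦⟧¹≈⟦⟧ℤ (i ℤ.* j))
        (trans (*-homo i j) (sym (*-cong (⟦⟧¹≈⟦⟧ℤ i) (⟦⟧¹≈⟦⟧ℤ j))))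
    ; -‿homo = λ i → trans (⟦⟧¹≈⟦⟧ℤ (ℤ.- i))
        (trans (-‿homo i) (sym (-‿cong (⟦⟧¹≈⟦⟧ℤ i))))
    ; 0-homo = refl
    ; 1-homo = refl
    }

  _coeff¹≟_ : ∀ i j → Maybe (⟦ i ⟧¹ ≈ ⟦ j ⟧¹)
  i coeff¹≟ j =
    map (λ p → trans (⟦⟧¹≈⟦⟧ℤ i) (trans p (sym (⟦⟧¹≈⟦⟧ℤ j)))) (i coeff≟ j)

  open RingSolver ℤ-rawRing (fromCommutativeRing R) morphism _coeff¹≟_ public
    using (solve; _:=_; _:+_; _:*_; _:-_; :-_; con; Polynomial)

  :0 :1 : ∀ {n} → Polynomial n
  :0 = con ℤ.0ℤ
  :1 = con ℤ.1ℤ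

-- Triangular exponents, inverses and q-shifted factorials.

[1+n]C2≡nC2+n : ∀ n → suc n C 2 ≡ n C 2 ℕ.+ n
[1+n]C2≡nC2+n n = begin
  suc n C 2         ≡⟨ nCk+nC[k+1]≡[n+1]C[k+1] n 1 ⟨
  n C 1 ℕ.+ n C 2   ≡⟨ ≡.cong (ℕ._+ n C 2) (nC1≡n n) ⟩
  n ℕ.+ n C 2       ≡⟨ ℕ.+-comm n (n C 2) ⟩
  n C 2 ℕ.+ n       ∎
  where open ≡.≡-Reasoning

module QBinomialSums {c ℓ₁ ℓ₂} (K : HeytingField c ℓ₁ ℓ₂) where
  open HeytingField K using (heytingCommutativeRing; _#_; #⇒invertible)
  open HeytingCommutativeRing heytingCommutativeRing using (commutativeRing)
  open CommutativeRing commutativeRing hiding (zero)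
  open HeytingProperties heytingCommutativeRing using (x-0≈x; x#0y#0→xy#0)
  open RingProperties ring using (-1*x≈-x)
  open SemiringExp semiring using (^-congˡ; ^-congʳ; ^-homo-*; ^-assocʳ)
  open CommutativeSemiringExp commutativeSemiring using (^-distrib-*)
  open SemiringMult semiring using (×-assoc-*; ×-congʳ)
  open SemiringSum semiring
    using (sum-cong-≋; sum-cong-≗; sum-init-last; ∑-distrib-+; *-distribˡ-sum)
  module Product = CommutativeMonoidSum *-commutativeMonoid
  open QSeries K
  open UnitalSolver commutativeRing
  open ≈-Reasoning setoid

  inv-inverseʳ : ∀ x (x#0 : x # 0#) → x * inv x x#0 ≈ 1#
  inv-inverseʳ x x#0 with #⇒invertible x#0
  ... | v , _ , [x-0]*v≈1 = trans (*-congʳ (sym (x-0≈x x))) [x-0]*v≈1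

  zpow-neg : ∀ x x#0 n → zpow x x#0 (-ᶻ (+ n)) ≈ inv x x#0 ^ n
  zpow-neg x x#0 zero    = refl
  zpow-neg x x#0 (suc n) = refl

  ^-inverse : ∀ {x y} → x * y ≈ 1# → ∀ n → x ^ n * y ^ n ≈ 1#
  ^-inverse xy≈1 zero = *-identityˡ 1#
  ^-inverse {x} {y} xy≈1 (suc n) = begin
    x * x ^ n * (y * y ^ n)     ≈⟨ solve 4 (λ x y a b → x :* a :* (y :* b) := x :* y :* (a :* b))
                                     refl x y (x ^ n) (y ^ n) ⟩
    x * y * (x ^ n * y ^ n)     ≈⟨ *-cong xy≈1 (^-inverse xy≈1 n) ⟩
    1# * 1#                     ≈⟨ *-identityˡ 1# ⟩
    1#                          ∎

  ^-C2-suc : ∀ x n → x ^ (suc n C 2) ≈ x ^ (n C 2) * x ^ n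
  ^-C2-suc x n = trans (^-congʳ x ([1+n]C2≡nC2+n n)) (^-homo-* x (n C 2) n)

  sum-last : ∀ n (f : ℕ → Carrier) →
             sum {suc n} (f ∘ toℕ) ≈ sum {n} (f ∘ toℕ) + f n
  sum-last n f = begin
    sum {suc n} (f ∘ toℕ)
      ≈⟨ sum-init-last {n} (f ∘ toℕ) ⟩
    sum {n} (f ∘ toℕ ∘ inject₁) + f (toℕ (fromℕ n))
      ≡⟨ ≡.cong₂ _+_ (sum-cong-≗ (≡.cong f ∘ toℕ-inject₁ {n = n})) (≡.cong f (toℕ-fromℕ n)) ⟩
    sum {n} (f ∘ toℕ) + f n
      ∎

  qPoch-last : ∀ a q n → qPoch a q (suc n) ≈ qPoch a q n * (1# - a * q ^ n)
  qPoch-last a q n = begin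
    qPoch a q (suc n)
      ≈⟨ Product.sum-init-last {n} (f ∘ toℕ) ⟩
    product {n} (f ∘ toℕ ∘ inject₁) * f (toℕ (fromℕ n))
      ≡⟨ ≡.cong₂ _*_ (Product.sum-cong-≗ (≡.cong f ∘ toℕ-inject₁ {n = n})) (≡.cong f (toℕ-fromℕ n)) ⟩
    qPoch a q n * f n
      ∎
    where
    f : ℕ → Carrier
    f j = 1# - a * q ^ j

  qPoch-first : ∀ a q n → qPoch a q (suc n) ≈ (1# - a) * qPoch (q * a) q n
  qPoch-first a q n = *-cong (+-congˡ (-‿cong (*-identityʳ a)))
    (Product.sum-cong-≋ {n} λ j → +-congˡ (-‿cong
      (solve 3 (λ a q y → a :* (q :* y) := q :* a :* y) refl a q (q ^ toℕ j))))

  qPoch-congˡ : ∀ {a b} q n → a ≈ b → qPoch a q n ≈ qPoch b q n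
  qPoch-congˡ q n a≈b = Product.sum-cong-≋ {n} λ _ → +-congˡ (-‿cong (*-congʳ a≈b))

  -- The factor of index `m` is `1# - a * q ^ m`, and `m <ᴺ n` puts it in the product. Peeling off
  -- first factors replaces `a` by `q * a` and lowers `m`, until that factor comes first.
  qPoch-vanishes : ∀ {a q m n} → m <ᴺ n → a * q ^ m ≈ 1# → qPoch a q n ≈ 0#
  qPoch-vanishes {a} {q} {zero} {suc n} z<s a≈1 = begin
    (1# - a * 1#) * _     ≈⟨ *-congʳ (+-congˡ (-‿cong a≈1)) ⟩
    (1# - 1#) * _         ≈⟨ *-congʳ (-‿inverseʳ 1#) ⟩
    0# * _                ≈⟨ zeroˡ _ ⟩
    0#                    ∎
  qPoch-vanishes {a} {q} {suc m} {suc n} (s<s m<n) aqᵐ⁺¹≈1 = begin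
    qPoch a q (suc n)                 ≈⟨ qPoch-first a q n ⟩
    (1# - a) * qPoch (q * a) q n      ≈⟨ *-congˡ (qPoch-vanishes m<n qaqᵐ≈1) ⟩
    (1# - a) * 0#                     ≈⟨ zeroʳ _ ⟩
    0#                                ∎
    where
    qaqᵐ≈1 : q * a * q ^ m ≈ 1#
    qaqᵐ≈1 = trans (solve 3 (λ a q y → q :* a :* y := a :* (q :* y)) refl a q (q ^ m)) aqᵐ⁺¹≈1

  -- Signed q-binomial coefficients.

  module _ (q : Carrier) where

    ⟨q⟩_ : ℕ → Carrier
    ⟨q⟩_ = qPoch q q

    σ : ℕ → Carrier
    σ k = (- 1#) ^ k * q ^ (k C 2)

    -- (-1)ᵏ q^(k C 2) [n k], by Pascal's rule; unlike qBinom it is 0 for k > n.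
    coeff : ℕ → ℕ → Carrier
    coeff n       zero    = 1#
    coeff zero    (suc k) = 0#
    coeff (suc n) (suc k) = q ^ suc k * coeff n (suc k) - q ^ k * coeff n k

    σ-suc : ∀ k → σ (suc k) ≈ - (q ^ k * σ k)
    σ-suc k = begin
      - 1# * (- 1#) ^ k * q ^ (suc k C 2)
        ≈⟨ *-cong (-1*x≈-x _) (^-C2-suc q k) ⟩
      - ((- 1#) ^ k) * (q ^ (k C 2) * q ^ k)
        ≈⟨ solve 3 (λ s c y → :- s :* (c :* y) := :- (y :* (s :* c)))
             refl ((- 1#) ^ k) (q ^ (k C 2)) (q ^ k) ⟩
      - (q ^ k * σ k)
        ∎

    coeff-beyond : ∀ {n k} → n <ᴺ k → coeff n k ≈ 0#
    coeff-beyond {zero}  {suc k} _ = refl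
    coeff-beyond {suc n} {suc k} (s<s n<k) = begin
      q ^ suc k * coeff n (suc k) - q ^ k * coeff n k
        ≈⟨ +-cong (*-congˡ (coeff-beyond (ℕ.m<n⇒m<1+n n<k))) (-‿cong (*-congˡ (coeff-beyond n<k))) ⟩
      q ^ suc k * 0# - q ^ k * 0#
        ≈⟨ solve 2 (λ x y → x :* :0 :- y :* :0 := :0) refl (q ^ suc k) (q ^ k) ⟩
      0#
        ∎

    -- The factorial formula for the q-binomial coefficient with denominators cleared. Writing n =
    -- `i + j` avoids both division and truncated subtraction.
    coeff-factorials : ∀ i j → coeff (i ℕ.+ j) i * (⟨q⟩ i * ⟨q⟩ j) ≈ σ i * ⟨q⟩ (i ℕ.+ j)
    -- This is the other neighbour in Pascal's rule. The factor `1# - q ^ j` completes (q;q)ⱼ₋₁ to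
    -- (q;q)ⱼ, so that `j` = 0 needs no (q;q)₋₁.
    coeff-factorials-suc : ∀ i j →
      coeff (i ℕ.+ j) (suc i) * (⟨q⟩ suc i * ⟨q⟩ j) ≈ σ (suc i) * ((1# - q ^ j) * ⟨q⟩ (i ℕ.+ j))

    coeff-factorials zero    j = solve 1 (λ x → :1 :* (:1 :* x) := :1 :* :1 :* x) refl (⟨q⟩ j)
    coeff-factorials (suc i) j = begin
      (q ^ suc i * a - q ^ i * b) * (⟨q⟩ suc i * ⟨q⟩ j)
        ≈⟨ solve 5 (λ x y a b z → (x :* a :- y :* b) :* z := x :* (a :* z) :- y :* (b :* z))
             refl (q ^ suc i) (q ^ i) a b (⟨q⟩ suc i * ⟨q⟩ j) ⟩
      q ^ suc i * (a * (⟨q⟩ suc i * ⟨q⟩ j)) - q ^ i * (b * (⟨q⟩ suc i * ⟨q⟩ j))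
        ≈⟨ +-cong (*-congˡ (coeff-factorials-suc i j))
                  (-‿cong (*-congˡ (*-congˡ (*-congʳ (qPoch-last q q i))))) ⟩
      q ^ suc i * (σ (suc i) * ((1# - q ^ j) * ⟨q⟩ (i ℕ.+ j)))
        - q ^ i * (b * (⟨q⟩ i * (1# - q ^ suc i) * ⟨q⟩ j))
        ≈⟨ +-congˡ (solve 5 (λ y b u v w → :- (y :* (b :* (u :* v :* w))) := :- (y :* (b :* (u :* w)) :* v))
             refl (q ^ i) b (⟨q⟩ i) (1# - q ^ suc i) (⟨q⟩ j)) ⟩
      q ^ suc i * (σ (suc i) * ((1# - q ^ j) * ⟨q⟩ (i ℕ.+ j)))
        + - (q ^ i * (b * (⟨q⟩ i * ⟨q⟩ j)) * (1# - q ^ suc i))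
        ≈⟨ +-congˡ (-‿cong (*-congʳ (*-congˡ (coeff-factorials i j)))) ⟩
      q ^ suc i * (σ (suc i) * ((1# - q ^ j) * ⟨q⟩ (i ℕ.+ j)))
        + - (q ^ i * (σ i * ⟨q⟩ (i ℕ.+ j)) * (1# - q ^ suc i))
        ≈⟨ +-congˡ (solve 4 (λ y s p z → :- (y :* (s :* p) :* z) := (:- (y :* s)) :* (p :* z))
             refl (q ^ i) (σ i) (⟨q⟩ (i ℕ.+ j)) (1# - q ^ suc i)) ⟩
      q ^ suc i * (σ (suc i) * ((1# - q ^ j) * ⟨q⟩ (i ℕ.+ j)))
        + - (q ^ i * σ i) * (⟨q⟩ (i ℕ.+ j) * (1# - q ^ suc i))
        ≈⟨ +-congˡ (*-congʳ (σ-suc i)) ⟨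
      q ^ suc i * (σ (suc i) * ((1# - q ^ j) * ⟨q⟩ (i ℕ.+ j)))
        + σ (suc i) * (⟨q⟩ (i ℕ.+ j) * (1# - q ^ suc i))
        -- With u = `q ^ suc i` and v = `q ^ j`, the two brackets combine by u(1 - v) + (1 - u) = 1
        -- - uv, the last factor of (q;q)ᵢ₊ⱼ₊₁.
        ≈⟨ solve 5 (λ q x y s p → q :* x :* (s :* ((:1 :- y) :* p)) :+ s :* (p :* (:1 :- q :* x))
                       := s :* (p :* (:1 :- q :* (x :* y))))
             refl q (q ^ i) (q ^ j) (σ (suc i)) (⟨q⟩ (i ℕ.+ j)) ⟩
      σ (suc i) * (⟨q⟩ (i ℕ.+ j) * (1# - q * (q ^ i * q ^ j)))
        ≈⟨ *-congˡ (*-congˡ (+-congˡ (-‿cong (*-congˡ (^-homo-* q i j))))) ⟨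
      σ (suc i) * (⟨q⟩ (i ℕ.+ j) * (1# - q * q ^ (i ℕ.+ j)))
        ≈⟨ *-congˡ (qPoch-last q q (i ℕ.+ j)) ⟨
      σ (suc i) * ⟨q⟩ suc (i ℕ.+ j)
        ∎
      where
      a b : Carrier
      a = coeff (i ℕ.+ j) (suc i)
      b = coeff (i ℕ.+ j) i

    coeff-factorials-suc i zero = begin
      coeff (i ℕ.+ 0) (suc i) * (⟨q⟩ suc i * 1#)
        -- Both sides vanish: the left because the lower index exceeds the upper one, the right
        -- because of the factor 1 - q⁰.
        ≈⟨ *-congʳ (coeff-beyond (s≤s (ℕ.≤-reflexive (ℕ.+-identityʳ i)))) ⟩
      0# * (⟨q⟩ suc i * 1#)
        ≈⟨ solve 3 (λ x s p → :0 :* (x :* :1) := s :* ((:1 :- :1) :* p))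
             refl (⟨q⟩ suc i) (σ (suc i)) (⟨q⟩ (i ℕ.+ 0)) ⟩
      σ (suc i) * ((1# - 1#) * ⟨q⟩ (i ℕ.+ 0))
        ∎
    coeff-factorials-suc i (suc j) = begin
      coeff (i ℕ.+ suc j) (suc i) * (⟨q⟩ suc i * ⟨q⟩ suc j)
        ≡⟨ ≡.cong (λ n → coeff n (suc i) * (⟨q⟩ suc i * ⟨q⟩ suc j)) (ℕ.+-suc i j) ⟩
      coeff (suc i ℕ.+ j) (suc i) * (⟨q⟩ suc i * ⟨q⟩ suc j)
        ≈⟨ *-congˡ (*-congˡ (qPoch-last q q j)) ⟩
      coeff (suc i ℕ.+ j) (suc i) * (⟨q⟩ suc i * (⟨q⟩ j * (1# - q ^ suc j)))
        ≈⟨ solve 4 (λ c u v z → c :* (u :* (v :* z)) := c :* (u :* v) :* z)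
             refl (coeff (suc i ℕ.+ j) (suc i)) (⟨q⟩ suc i) (⟨q⟩ j) (1# - q ^ suc j) ⟩
      coeff (suc i ℕ.+ j) (suc i) * (⟨q⟩ suc i * ⟨q⟩ j) * (1# - q ^ suc j)
        ≈⟨ *-congʳ (coeff-factorials (suc i) j) ⟩
      σ (suc i) * ⟨q⟩ (suc i ℕ.+ j) * (1# - q ^ suc j)
        ≈⟨ solve 3 (λ s p z → s :* p :* z := s :* (z :* p))
             refl (σ (suc i)) (⟨q⟩ (suc i ℕ.+ j)) (1# - q ^ suc j) ⟩
      σ (suc i) * ((1# - q ^ suc j) * ⟨q⟩ (suc i ℕ.+ j))
        ≡⟨ ≡.cong (λ n → σ (suc i) * ((1# - q ^ suc j) * ⟨q⟩ n)) (ℕ.+-suc i j) ⟨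
      σ (suc i) * ((1# - q ^ suc j) * ⟨q⟩ (i ℕ.+ suc j))
        ∎

    -- Both sides have the same product with `d`, by `coeff-factorials`, and `d` is invertible.
    σ*quotient≈coeff : QFactorials#0 q → ∀ {n k x} → k ℕ.≤ n →
      x * (⟨q⟩ k * ⟨q⟩ (n ∸ k)) ≈ ⟨q⟩ n → σ k * x ≈ coeff n k
    σ*quotient≈coeff nz {n} {k} {x} k≤n x*d≈[q]ₙ = begin
      σ k * x                         ≈⟨ *-identityʳ _ ⟨
      σ k * x * 1#                    ≈⟨ *-congˡ (inv-inverseʳ d d#0) ⟨
      σ k * x * (d * inv d d#0)       ≈⟨ solve 4 (λ s x d v → s :* x :* (d :* v) := s :* (x :* d) :* v)
                                           refl (σ k) x d (inv d d#0) ⟩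
      σ k * (x * d) * inv d d#0       ≈⟨ *-congʳ (*-congˡ x*d≈[q]ₙ) ⟩
      σ k * ⟨q⟩ n * inv d d#0         ≈⟨ *-congʳ σ*[q]ₙ≈coeff*d ⟩
      coeff n k * d * inv d d#0       ≈⟨ *-assoc _ _ _ ⟩
      coeff n k * (d * inv d d#0)     ≈⟨ *-congˡ (inv-inverseʳ d d#0) ⟩
      coeff n k * 1#                  ≈⟨ *-identityʳ _ ⟩
      coeff n k                       ∎
      where
      d : Carrier
      d = ⟨q⟩ k * ⟨q⟩ (n ∸ k)

      d#0 : d # 0#
      d#0 = x#0y#0→xy#0 (nz k) (nz (n ∸ k))

      σ*[q]ₙ≈coeff*d : σ k * ⟨q⟩ n ≈ coeff n k * d
      σ*[q]ₙ≈coeff*d = ≡.subst (λ l → σ k * ⟨q⟩ l ≈ coeff l k * d)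
        (ℕ.m+[n∸m]≡n k≤n) (sym (coeff-factorials k (n ∸ k)))

    -- The functionals Lₙ and the q-binomial theorem.

    L : ℕ → (ℕ → Carrier) → Carrier
    L n w = sum {suc n} (λ i → coeff n (toℕ i) * w (toℕ i))

    L-cong : ∀ n {v w} → (∀ k → v k ≈ w k) → L n v ≈ L n w
    L-cong n v≈w = sum-cong-≋ {suc n} λ i → *-congˡ {coeff n (toℕ i)} (v≈w (toℕ i))

    L-linear : ∀ n a b v w → L n (λ k → a * v k + b * w k) ≈ a * L n v + b * L n w
    L-linear n a b v w = begin
      L n (λ k → a * v k + b * w k)
        ≈⟨ sum-cong-≋ {suc n} (λ i →
             solve 5 (λ c a b v w → c :* (a :* v :+ b :* w) := a :* (c :* v) :+ b :* (c :* w))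
               refl (coeff n (toℕ i)) a b (v (toℕ i)) (w (toℕ i))) ⟩
      sum {suc n} (λ i → a * term v i + b * term w i)
        ≈⟨ ∑-distrib-+ {suc n} (λ i → a * term v i) (λ i → b * term w i) ⟩
      sum {suc n} (λ i → a * term v i) + sum {suc n} (λ i → b * term w i)
        ≈⟨ +-cong (*-distribˡ-sum {suc n} a (term v)) (*-distribˡ-sum {suc n} b (term w)) ⟨
      a * L n v + b * L n w
        ∎
      where
      term : (ℕ → Carrier) → Fin (suc n) → Carrier
      term u i = coeff n (toℕ i) * u (toℕ i)

    -- Summation by parts: Pascal's rule makes each coefficient a difference `f′ (k + 1) - f′ k`.
    -- Shifting the index in the first half moves the difference onto `w`, and the boundary term
    -- `f (suc n)` is 0.
    L-suc : ∀ n w → L (suc n) w ≈ L n (λ k → q ^ k * (w k - w (suc k)))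
    L-suc n w = begin
      1# * w 0 + sum {suc n} (λ i → (f′ (suc (toℕ i)) - f′ (toℕ i)) * w (suc (toℕ i)))
        -- The term at k = 0 equals `f 0`, which is exactly what the shifted sum of `f` lacks.
        ≈⟨ +-cong (solve 1 (λ x → :1 :* x := :1 :* :1 :* x) refl (w 0))
             (sum-cong-≋ {suc n} λ i →
               solve 3 (λ x y z → (x :- y) :* z := x :* z :+ (:- (y :* z)))
                 refl (f′ (suc (toℕ i))) (f′ (toℕ i)) (w (suc (toℕ i)))) ⟩
      f 0 + sum {suc n} (λ i → f (suc (toℕ i)) + g (toℕ i))
        ≈⟨ +-congˡ (∑-distrib-+ {suc n} (f ∘ suc ∘ toℕ) (g ∘ toℕ)) ⟩
      f 0 + (sum {suc n} (f ∘ suc ∘ toℕ) + sum {suc n} (g ∘ toℕ))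
        ≈⟨ +-assoc _ _ _ ⟨
      sum {suc (suc n)} (f ∘ toℕ) + sum {suc n} (g ∘ toℕ)
        ≈⟨ +-congʳ (sum-last (suc n) f) ⟩
      sum {suc n} (f ∘ toℕ) + f (suc n) + sum {suc n} (g ∘ toℕ)
        ≈⟨ +-congʳ (trans (+-congˡ f[1+n]≈0) (+-identityʳ _)) ⟩
      sum {suc n} (f ∘ toℕ) + sum {suc n} (g ∘ toℕ)
        ≈⟨ ∑-distrib-+ {suc n} (f ∘ toℕ) (g ∘ toℕ) ⟨
      sum {suc n} (λ i → f (toℕ i) + g (toℕ i))
        ≈⟨ sum-cong-≋ {suc n} (λ i →
             solve 4 (λ y c u v → y :* c :* u :+ (:- (y :* c :* v)) := c :* (y :* (u :- v)))
               refl (q ^ toℕ i) (coeff n (toℕ i)) (w (toℕ i)) (w (suc (toℕ i)))) ⟩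
      L n (λ k → q ^ k * (w k - w (suc k)))
        ∎
      where
      f′ f g : ℕ → Carrier
      f′ k = q ^ k * coeff n k
      f  k = f′ k * w k
      g  k = - (f′ k * w (suc k))

      f[1+n]≈0 : f (suc n) ≈ 0#
      f[1+n]≈0 = trans (*-congʳ (*-congˡ (coeff-beyond (ℕ.n<1+n n))))
        (solve 2 (λ x y → x :* :0 :* y := :0) refl (q ^ suc n) (w (suc n)))

    -- For w(k) = xᵏ the summand of `L-suc` is qᵏ(xᵏ - xᵏ⁺¹) = (1 - x)(qx)ᵏ, so both sides satisfy
    -- the same recursion, passing from x to qx.
    q-binomial-theorem : ∀ n x → L n (x ^_) ≈ qPoch x q n
    q-binomial-theorem zero    x = solve 0 (:1 :* :1 :+ :0 := :1) refl
    q-binomial-theorem (suc n) x = begin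
      L (suc n) (x ^_)
        ≈⟨ L-suc n (x ^_) ⟩
      L n (λ k → q ^ k * (x ^ k - x * x ^ k))
        -- The zero summand brings the expression to the two-term form of `L-linear`.
        ≈⟨ L-cong n (λ k → trans
             (solve 3 (λ x y z → y :* (z :- x :* z) := (:1 :- x) :* (y :* z) :+ :0 :* (y :* z))
               refl x (q ^ k) (x ^ k))
             (sym (+-cong (*-congˡ (^-distrib-* q x k)) (*-congˡ (^-distrib-* q x k))))) ⟩
      L n (λ k → (1# - x) * (q * x) ^ k + 0# * (q * x) ^ k)
        ≈⟨ L-linear n (1# - x) 0# ((q * x) ^_) ((q * x) ^_) ⟩
      (1# - x) * L n ((q * x) ^_) + 0# * L n ((q * x) ^_)
        ≈⟨ trans (+-congˡ (zeroˡ _)) (+-identityʳ _) ⟩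
      (1# - x) * L n ((q * x) ^_)
        ≈⟨ *-congˡ (q-binomial-theorem n (q * x)) ⟩
      (1# - x) * qPoch (q * x) q n
        ≈⟨ qPoch-first x q n ⟨
      qPoch x q (suc n)
        ∎

    -- The image of (x;q)ₙ under the operator x d/dx.

    D : ℕ → Carrier → Carrier
    D n x = L n (λ k → (k · 1#) * x ^ k)

    D-cong : ∀ n {x y} → x ≈ y → D n x ≈ D n y
    D-cong n x≈y = L-cong n λ k → *-congˡ {k · 1#} (^-congˡ k x≈y)

    -- This is the product rule for (1 - x)(qx;q)ₙ under x d/dx. On coefficients it reads qᵏ(k xᵏ -
    -- (k+1) xᵏ⁺¹) = (1 - x) k (qx)ᵏ - x (qx)ᵏ.
    D-suc : ∀ n x → D (suc n) x ≈ (1# - x) * D n (q * x) + (- x) * qPoch (q * x) q n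
    D-suc n x = begin
      D (suc n) x
        ≈⟨ L-suc n (λ k → (k · 1#) * x ^ k) ⟩
      L n (λ k → q ^ k * ((k · 1#) * x ^ k - (1# + k · 1#) * (x * x ^ k)))
        ≈⟨ L-cong n (λ k → trans
             (solve 4 (λ a x y z → y :* (a :* z :- (:1 :+ a) :* (x :* z))
                           := (:1 :- x) :* (a :* (y :* z)) :+ (:- x) :* (y :* z))
               refl (k · 1#) x (q ^ k) (x ^ k))
             (sym (+-cong (*-congˡ (*-congˡ (^-distrib-* q x k))) (*-congˡ (^-distrib-* q x k))))) ⟩
      L n (λ k → (1# - x) * ((k · 1#) * (q * x) ^ k) + (- x) * (q * x) ^ k)
        ≈⟨ L-linear n (1# - x) (- x) (λ k → (k · 1#) * (q * x) ^ k) ((q * x) ^_) ⟩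
      (1# - x) * D n (q * x) + (- x) * L n ((q * x) ^_)
        ≈⟨ +-congˡ (*-congˡ (q-binomial-theorem n (q * x))) ⟩
      (1# - x) * D n (q * x) + (- x) * qPoch (q * x) q n
        ∎

    -- Each descent from m to m - 1 lowers n as well, so n - m - 1 is constant. It contributes 1 -
    -- pᵐ = -pᵐ(1 - qᵐ), and these factors build up the sign, the triangular power of `p` and
    -- (q;q)ₘ.
    D-at-inverse-power : ∀ {p} → q * p ≈ 1# → ∀ {m n} → m <ᴺ n →
      D n (p ^ m) ≈ (- 1#) ^ suc m * p ^ (suc m C 2) * ⟨q⟩ m * ⟨q⟩ (n ∸ m ∸ 1)
    D-at-inverse-power {p} qp≈1 {zero} {suc n} z<s = begin
      D (suc n) 1#
        ≈⟨ D-suc n 1# ⟩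
      (1# - 1#) * D n (q * 1#) + (- 1#) * qPoch (q * 1#) q n
        ≈⟨ +-congˡ (*-congˡ (qPoch-congˡ q n (*-identityʳ q))) ⟩
      (1# - 1#) * D n (q * 1#) + (- 1#) * ⟨q⟩ n
        ≈⟨ solve 2 (λ d x → (:1 :- :1) :* d :+ (:- :1) :* x := (:- :1) :* :1 :* :1 :* :1 :* x)
             refl (D n (q * 1#)) (⟨q⟩ n) ⟩
      (- 1#) * 1# * 1# * 1# * ⟨q⟩ n
        ∎
    D-at-inverse-power {p} qp≈1 {suc m} {suc n} (s<s m<n) = begin
      D (suc n) p′
        ≈⟨ D-suc n p′ ⟩
      (1# - p′) * D n (q * p′) + (- p′) * qPoch (q * p′) q n
        -- Since q pᵐ⁺¹ = pᵐ and pᵐ qᵐ = 1 with `m <ᴺ n`, the q-shifted factorial contains a zero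
        -- factor.
        ≈⟨ +-cong (*-congˡ (D-cong n qp′≈pᵐ)) (*-congˡ (trans (qPoch-congˡ q n qp′≈pᵐ)
             (qPoch-vanishes m<n (trans (*-comm _ _) (^-inverse qp≈1 m))))) ⟩
      (1# - p′) * D n (p ^ m) + (- p′) * 0#
        -- The 1 is written as qᵐ⁺¹ pᵐ⁺¹, so that `p′` can be factored out of the difference.
        ≈⟨ +-cong (*-cong (+-congʳ (sym (^-inverse qp≈1 (suc m)))) (D-at-inverse-power qp≈1 m<n)) (zeroʳ _) ⟩
      (q ^ suc m * p′ - p′) * (s * c′ * ⟨q⟩ m * r) + 0#
        ≈⟨ solve 6 (λ y p s c u r → (y :* p :- p) :* (s :* c :* u :* r) :+ :0
                        := (:- :1) :* s :* (c :* p) :* (u :* (:1 :- y)) :* r)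
             refl (q ^ suc m) p′ s c′ (⟨q⟩ m) r ⟩
      (- 1#) * s * (c′ * p′) * (⟨q⟩ m * (1# - q ^ suc m)) * r
        ≈⟨ *-congʳ (*-cong (*-congˡ (^-C2-suc p (suc m))) (qPoch-last q q m)) ⟨
      (- 1#) ^ suc (suc m) * p ^ (suc (suc m) C 2) * ⟨q⟩ suc m * r
        ∎
      where
      p′ s c′ r : Carrier
      p′ = p ^ suc m
      s  = (- 1#) ^ suc m
      c′ = p ^ (suc m C 2)
      r  = ⟨q⟩ (n ∸ m ∸ 1)

      qp′≈pᵐ : q * p′ ≈ p ^ m
      qp′≈pᵐ = trans (sym (*-assoc q p _)) (trans (*-congʳ qp≈1) (*-identityˡ _))

    -- Passage from the weighted sum to `D`.

    -- The q-binomial coefficients enter only as quotients x k of (q;q)ₙ by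
    -- (q;q)ₖ (q;q)ₙ₋ₖ, so that nothing depends on how the quotient was formed.
    ∑-weighted-quotients : (q#0 : q # 0#) → QFactorials#0 q →
      ∀ {m n} → m <ᴺ n → (x : Fin n → Carrier) →
      (∀ i → x i * (⟨q⟩ suc (toℕ i) * ⟨q⟩ (n ∸ suc (toℕ i))) ≈ ⟨q⟩ n) →
      sum {n} (λ i → suc (toℕ i) ·
        (σ (suc (toℕ i)) * x i * zpow q q#0 (-ᶻ (+ (m *ᴺ suc (toℕ i))))))
      ≈ (- 1#) ^ suc m * zpow q q#0 (-ᶻ (+ (suc m C 2))) * ⟨q⟩ m * ⟨q⟩ (n ∸ m ∸ 1)
    ∑-weighted-quotients q#0 nz {m} {n} m<n x x*d≈[q]ₙ = begin
      sum {n} (λ i → suc (toℕ i) ·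
        (σ (suc (toℕ i)) * x i * zpow q q#0 (-ᶻ (+ (m *ᴺ suc (toℕ i))))))
        ≈⟨ sum-cong-≋ {n} (λ i → summand (toℕ<n i) (x*d≈[q]ₙ i)) ⟩
      ∑[1⋯ n ] (λ k → coeff n k * ((k · 1#) * (p ^ m) ^ k))
        -- `D` starts at k = 0, where the weight k makes the term 0.
        ≈⟨ solve 1 (λ x → x := :1 :* (:0 :* :1) :+ x) refl _ ⟩
      D n (p ^ m)
        ≈⟨ D-at-inverse-power (inv-inverseʳ q q#0) m<n ⟩
      (- 1#) ^ suc m * p ^ (suc m C 2) * ⟨q⟩ m * ⟨q⟩ (n ∸ m ∸ 1)
        ≈⟨ *-congʳ (*-congʳ (*-congˡ (zpow-neg q q#0 (suc m C 2)))) ⟨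
      (- 1#) ^ suc m * zpow q q#0 (-ᶻ (+ (suc m C 2))) * ⟨q⟩ m * ⟨q⟩ (n ∸ m ∸ 1)
        ∎
      where
      p : Carrier
      p = inv q q#0

      summand : ∀ {k y} → k ℕ.≤ n → y * (⟨q⟩ k * ⟨q⟩ (n ∸ k)) ≈ ⟨q⟩ n →
        k · (σ k * y * zpow q q#0 (-ᶻ (+ (m *ᴺ k))))
        ≈ coeff n k * ((k · 1#) * (p ^ m) ^ k)
      summand {k} {y} k≤n y*d≈[q]ₙ = begin
        k · (σ k * y * zpow q q#0 (-ᶻ (+ (m *ᴺ k))))
          ≈⟨ ×-congʳ k (*-cong (σ*quotient≈coeff nz k≤n y*d≈[q]ₙ)
               (trans (zpow-neg q q#0 (m *ᴺ k)) (sym (^-assocʳ p m k)))) ⟩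
        k · (coeff n k * (p ^ m) ^ k)
          -- The inserted unit absorbs the multiplicity, turning a k-fold sum into a product with
          -- the scalar `k · 1#`.
          ≈⟨ ×-congʳ k (*-identityˡ _) ⟨
        k · (1# * (coeff n k * (p ^ m) ^ k))
          ≈⟨ ×-assoc-* k 1# _ ⟨
        (k · 1#) * (coeff n k * (p ^ m) ^ k)
          ≈⟨ solve 3 (λ a c x → a :* (c :* x) := c :* (a :* x)) refl (k · 1#) (coeff n k) ((p ^ m) ^ k) ⟩
        coeff n k * ((k · 1#) * (p ^ m) ^ k)
          ∎

-- Reciprocals of complex numbers and the theorem over them.

module ComplexQuotients {c ℓ₁ ℓ₂} (ℝ : RealField c ℓ₁ ℓ₂) where
  open ComplexNumbers ℝ
  open QSeries ℂ-field
  private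
    module R = RealField ℝ
    module C = CommutativeRing ℂ-commutativeRing

  -- QSeries.inv z over ℂ reduces to this; the subtraction of 0ᶜ comes from the
  -- library's notion of apartness.
  recip : ∀ z → normSq (z +ᶜ -ᶜ 0ᶜ) R.# R.0# → ℂ
  recip z N#0 = mkℂ (re w R.* v) (R.- (im w R.* v))
    where
    w : ℂ
    w = z +ᶜ -ᶜ 0ᶜ

    v : Real
    v = proj₁ (R.#⇒invertible N#0)

  -- `recip` is the conjugate divided by the squared modulus: in the product with `z` the real part
  -- is v |z|² = 1, and the imaginary parts cancel.
  recip-inverseˡ : ∀ z N#0 → recip z N#0 *ᶜ z ≈ᶜ 1ᶜ
  recip-inverseˡ z N#0 with R.#⇒invertible N#0
  ... | v , v*[N-0]≈1 , _ =
      R.trans (solve 3 (λ a b v → (a :- :0) :* v :* a :- (:- ((b :- :0) :* v)) :* b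
                              := v :* ((a :- :0) :* (a :- :0) :+ (b :- :0) :* (b :- :0) :- :0))
                 R.refl (re z) (im z) v) v*[N-0]≈1
    , solve 3 (λ a b v → (a :- :0) :* v :* b :+ (:- ((b :- :0) :* v)) :* a := :0)
        R.refl (re z) (im z) v
    where open UnitalSolver R.commutativeRing

  -- The q-binomial coefficient is spelled out as (q;q)ₙ times a reciprocal, with arbitrary
  -- apartness proofs `N#0`. Multiplying by the denominator cancels the reciprocal, as the general
  -- quotient form requires.
  ∑-weighted-recips : ∀ {q m n} → m <ᴺ n → QFactorials#0 q → (q#0 : q #ᶜ 0ᶜ)
    (N#0 : (i : Fin n) →
      normSq (qPoch q q (suc (toℕ i)) *ᶜ qPoch q q (n ∸ suc (toℕ i)) +ᶜ -ᶜ 0ᶜ) R.# R.0#) →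
    sum {n} (λ i → suc (toℕ i) ·
      ((-ᶜ 1ᶜ) ^ suc (toℕ i) *ᶜ q ^ (suc (toℕ i) C 2)
        *ᶜ (qPoch q q n *ᶜ recip _ (N#0 i))
        *ᶜ zpow q q#0 (-ᶻ (+ (m *ᴺ suc (toℕ i))))))
    ≈ᶜ (-ᶜ 1ᶜ) ^ suc m *ᶜ zpow q q#0 (-ᶻ (+ (suc m C 2))) *ᶜ qPoch q q m *ᶜ qPoch q q (n ∸ m ∸ 1)
  ∑-weighted-recips {q} {n = n} m<n nz q#0 N#0 =
    QBinomialSums.∑-weighted-quotients ℂ-field q q#0 nz m<n
      (λ i → qPoch q q n *ᶜ recip _ (N#0 i))
      (λ i → C.trans (C.*-assoc _ _ _) (C.trans (C.*-congˡ (recip-inverseˡ _ (N#0 i))) (C.*-identityʳ _)))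

theorem2p2 : ∀ {c ℓ₁ ℓ₂} (ℝ : RealField c ℓ₁ ℓ₂) →
    let open ComplexNumbers ℝ in
    let open QSeries ℂ-field in
    let open UnitDisc ℝ in
    (q : ℂ) (r : Real) (|q|≈r : ∣ q ∣≈ r) (0<r : 0ʳ <ʳ r) (r<1 : r <ʳ 1ʳ)
    (m n : ℕ) → m <ᴺ n →
    let q#0 = modulus-pos⇒#0 |q|≈r 0<r in
    let nz = qFactorials#0 |q|≈r 0<r r<1 in
    ∑[1⋯ n ] (λ k → k · ((-ᶜ 1ᶜ) ^ k *ᶜ q ^ (k C 2) *ᶜ qBinom q nz n k *ᶜ zpow q q#0 (-ᶻ (+ (m *ᴺ k)))))
    ≈ᶜ
    (-ᶜ 1ᶜ) ^ suc m *ᶜ zpow q q#0 (-ᶻ (+ (suc m C 2))) *ᶜ qPoch q q m *ᶜ qPoch q q (n ∸ m ∸ 1)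
-- The last underscore stands for the N#0 hidden in qBinom.  Writing qBinom in the
-- lemma instead would make the type checker unfold the proofs of apartness.
theorem2p2 ℝ q r |q|≈r 0<r r<1 m n m<n =
  ComplexQuotients.∑-weighted-recips ℝ m<n (UnitDisc.qFactorials#0 ℝ |q|≈r 0<r r<1) _ _
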